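{- Let $G$ and $H$ be connected graphs. Then the cartesian product $G\square H$ is a hangable graph if and only if both $G$ and $H$ are hangable graphs.
   Context: All graphs are finite, simple, undirected, with nonempty vertex set. For a connected graph $G=(V_G,E_G)$, $d_G(u,v)$ is the length of a shortest $u$--$v$ path. The eccentricity of $v$ is $e_G(v)=\max\{d_G(v,u): u\in V_G\}$ and the diameter is $d(G)=\max\{e_G(v): v\in V_G\}$. The periphery of a vertex $v$ is $P_G(v)=\{u\in V_G: d_G(v,u)=e_G(v)\}$; the periphery of $G$ is $P(G)=\{v\in V_G: e_G(v)=d(G)\}$. A connected graph $G$ is hangable if $P_G(v)\subseteq P(G)$ for every $v\in V_G$. The cartesian product $G\square H$ is the graph with vertex set $V_G\times V_H$ in which $(a,b)$ and $(c,d)$ are adjacent if and only if ($ac\in E_G$ and $b=d$) or ($a=c$ and $bd\in E_H$). -}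

module Defs where

open import Data.Bool.Base using (if_then_else_)
open import Data.Fin.Base using (Fin)
import Data.Fin.Properties as Fin
open import Data.List.Base using (List; []; _∷_; map; allFin)
open import Data.List.Extrema.Nat using (max)
open import Data.List.Relation.Unary.Unique.Propositional using (Unique)
import Data.List.Relation.Unary.Unique.DecPropositional as DecUnique
open import Data.Nat.Base using (ℕ; zero; suc; _*_; NonZero)
open import Data.Nat.Properties using (m*n≢0)
open import Data.Product.Base using (∃; Σ-syntax; _×_; _,_)
open import Data.Product.Function.NonDependent.Propositional using (_×-↔_)
open import Data.Sum.Base using (_⊎_; inj₁; inj₂)
open import Function.Base using (_∘_)
open import Function.Bundles using (_↔_; Inverse)
open import Function.Construct.Composition using (_↔-∘_)
open import Function.Construct.Symmetry using (↔-sym)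
open import Function.Properties.Inverse using (↔⇒↣)
open import Relation.Binary.Definitions
  using (Decidable; DecidableEquality; Irreflexive; Symmetric)
open import Relation.Binary.PropositionalEquality
  using (_≡_; refl; sym; subst)
open import Relation.Nullary.Decidable
  using (Dec; yes; no; does; map′; _×-dec_; _⊎-dec_)
open import Relation.Unary as Unary using (Pred; _⊆_)
open import Level using (0ℓ)

record Graph : Set₁ where
  field
    V        : Set
    order    : ℕ
    finite   : V ↔ Fin order
    nonempty : NonZero order
    Adj      : V → V → Set
    adj?     : Decidable Adj
    irrefl   : Irreflexive _≡_ Adj
    symm     : Symmetric Adj

  open Inverse finite using (to; from; strictlyInverseʳ)

  _≟_ : DecidableEquality V
  _≟_ = Fin.inj⇒≟ (↔⇒↣ finite)

  vertices : List V
  vertices = map from (allFin order)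

  any? : {Q : Pred V 0ℓ} → Unary.Decidable Q → Dec (∃ Q)
  any? {Q} Q? = map′
    (λ (i , q) → from i , q)
    (λ (v , q) → to v , subst Q (sym (strictlyInverseʳ v)) q)
    (Fin.any? (Q? ∘ from))

-- The first k < n satisfying Q, and n if there is none.
leastBelow : {Q : Pred ℕ 0ℓ} → ℕ → Unary.Decidable Q → ℕ
leastBelow zero    Q? = zero
leastBelow (suc n) Q? =
  if does (Q? zero) then zero else suc (leastBelow n (Q? ∘ suc))

module _ (G : Graph) where
  open Graph G

  data Walk : V → V → ℕ → Set where
    []  : ∀ {v} → Walk v v zero
    _∷_ : ∀ {u w v k} → Adj u w → Walk w v k → Walk u v (suc k)

module _ {G : Graph} where
  open Graph G

  support : ∀ {u v k} → Walk G u v k → List V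
  support {u} []      = u ∷ []
  support {u} (_ ∷ p) = u ∷ support p

  walk? : {Q : Pred (List V) 0ℓ} → Unary.Decidable Q →
          ∀ u v k → Dec (Σ[ p ∈ Walk G u v k ] Q (support p))
  walk? Q? u v zero with u ≟ v
  ... | yes refl = map′ ([] ,_) (λ where ([] , q) → q) (Q? (u ∷ []))
  ... | no  u≢v  = no λ where ([] , _) → u≢v refl
  walk? Q? u v (suc k) = map′
    (λ (_ , a , p , q) → a ∷ p , q)
    (λ where (a ∷ p , q) → _ , a , p , q)
    (any? λ w → adj? u w ×-dec walk? (Q? ∘ (u ∷_)) w v k)

module _ (G : Graph) where
  open Graph G

  Path : V → V → ℕ → Set
  Path u v k = Σ[ p ∈ Walk G u v k ] Unique (support p)

  path? : ∀ u v → Unary.Decidable (Path u v)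
  path? = walk? (DecUnique.unique? _≟_)

  Connected : Set
  Connected = ∀ u v → ∃ (Path u v)

  -- A path has at most `order` vertices, so its length is below `order`;
  -- the search can only fail when no u–v path exists.
  d : V → V → ℕ
  d u v = leastBelow order (path? u v)

  ecc : V → ℕ
  ecc v = max 0 (map (d v) vertices)

  diam : ℕ
  diam = max 0 (map ecc vertices)

  PeripheryOf : V → Pred V 0ℓ
  PeripheryOf v u = d v u ≡ ecc v

  Periphery : Pred V 0ℓ
  Periphery v = ecc v ≡ diam

  Hangable : Set
  Hangable = Connected × (∀ v → PeripheryOf v ⊆ Periphery)

infixr 7 _□_

_□_ : Graph → Graph → Graph
G □ H = record
  { V        = G.V × H.V
  ; order    = G.order * H.order
  ; finite   = ↔-sym Fin.*↔× ↔-∘ (G.finite ×-↔ H.finite)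
  ; nonempty = m*n≢0 G.order H.order {{G.nonempty}} {{H.nonempty}}
  ; Adj      = λ (a , b) (c , d) → (G.Adj a c × b ≡ d) ⊎ (a ≡ c × H.Adj b d)
  ; adj?     = λ (a , b) (c , d) →
                 (G.adj? a c ×-dec b H.≟ d) ⊎-dec (a G.≟ c ×-dec H.adj? b d)
  ; irrefl   = λ where
      refl (inj₁ (e , _)) → G.irrefl refl e
      refl (inj₂ (_ , e)) → H.irrefl refl e
  ; symm     = λ where
      (inj₁ (e , b≡d)) → inj₁ (G.symm e , sym b≡d)
      (inj₂ (a≡c , e)) → inj₂ (sym a≡c , H.symm e)
  }
  where
  module G = Graph G
  module H = Graph H

{-# OPTIONS --safe #-}

-- Distances add up in a cartesian product: a walk in G □ H splits into its
-- G-steps and its H-steps, and conversely two walks can be run one after the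
-- other.  Hence eccentricities and diameters add up as well, and as each
-- summand is bounded by its maximum, a sum is maximal iff both summands are.

module Submission where

open import Defs
open import Data.Empty using (⊥-elim)
open import Data.Fin.Base using (zero; suc; fromℕ<)
import Data.Fin.Properties as Fin
open import Data.List.Base using (List; []; _∷_; map; length; lookup)
open import Data.List.Extrema.Nat using (max; xs≤max; argmax-sel)
open import Data.List.Membership.Propositional using (_∈_)
import Data.List.Membership.DecPropositional as DecMembership
open import Data.List.Membership.Propositional.Properties
  using (∈-map⁺; ∈-map⁻; ∈-allFin; ∈-lookup)
import Data.List.Relation.Unary.All as All
open import Data.List.Relation.Unary.All.Properties using (¬Any⇒All¬)
open import Data.List.Relation.Unary.AllPairs using ([]; _∷_)
open import Data.List.Relation.Unary.Any using (here; there)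
open import Data.List.Relation.Unary.Unique.Propositional using (Unique)
open import Data.Nat.Base using (ℕ; zero; suc; _+_; _≤_; _<_; z≤n; s≤s; s≤s⁻¹; >-nonZero⁻¹)
open import Data.Nat.Properties
  using (≤-refl; ≤-reflexive; ≤-trans; ≤-antisym; n≤0⇒n≡0; m≤n⇒m≤1+n; +-suc;
         +-mono-≤; +-monoʳ-≤; +-cancelʳ-≤; +-cancelˡ-≡)
open import Data.Product.Base using (∃; ∃₂; _×_; _,_; proj₁; proj₂)
open import Data.Sum.Base using (inj₁; inj₂)
open import Function.Base using (_∘_; id)
open import Function.Bundles using (_⇔_; mk⇔; Equivalence; Inverse; Injection)
open import Function.Properties.Inverse using (↔⇒↣)
open import Level using (0ℓ)
open import Relation.Binary.PropositionalEquality
  using (_≡_; refl; sym; trans; cong; cong₂; subst; subst₂)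
open import Relation.Nullary.Decidable using (yes; no)
open import Relation.Unary as Unary using (Pred)

-- A failed search returns `n`, and in that case every witness is at least `n`, so the bound also
-- covers witnesses beyond the search range.
leastBelow-≤ : {Q : Pred ℕ 0ℓ} (n : ℕ) (Q? : Unary.Decidable Q) →
               ∀ {k} → Q k → leastBelow n Q? ≤ k
leastBelow-≤ zero    Q? q = z≤n
leastBelow-≤ (suc n) Q? {k} q with Q? zero
... | yes _ = z≤n
leastBelow-≤ (suc n) Q? {zero}  q | no ¬q₀ = ⊥-elim (¬q₀ q)
leastBelow-≤ (suc n) Q? {suc k} q | no _   = s≤s (leastBelow-≤ n (Q? ∘ suc) q)

-- The default value `n` need not satisfy `Q`; a witness below `n` ensures that the search stops
-- earlier.
leastBelow-satisfies : {Q : Pred ℕ 0ℓ} (n : ℕ) (Q? : Unary.Decidable Q) →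
                       ∀ {k} → k < n → Q k → Q (leastBelow n Q?)
leastBelow-satisfies (suc n) Q? {k} k<n q with Q? zero
... | yes q₀ = q₀
leastBelow-satisfies (suc n) Q? {zero}  k<n q | no ¬q₀ = ⊥-elim (¬q₀ q)
leastBelow-satisfies (suc n) Q? {suc k} k<n q | no _   =
  leastBelow-satisfies n (Q? ∘ suc) (s≤s⁻¹ k<n) q

lookup-injective : ∀ {A : Set} {xs : List A} → Unique xs →
                   ∀ {i j} → lookup xs i ≡ lookup xs j → i ≡ j
lookup-injective (_  ∷ _)  {zero}  {zero}  _  = refl
lookup-injective (x∉ ∷ _)  {zero}  {suc j} eq = ⊥-elim (All.lookup x∉ (∈-lookup j) eq)
lookup-injective (x∉ ∷ _)  {suc i} {zero}  eq = ⊥-elim (All.lookup x∉ (∈-lookup i) (sym eq))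
lookup-injective (_  ∷ xs) {suc i} {suc j} eq = cong suc (lookup-injective xs eq)

m+n≡o+p⇒m≡o×n≡p : ∀ {m n o p} → m ≤ o → n ≤ p → m + n ≡ o + p → m ≡ o × n ≡ p
m+n≡o+p⇒m≡o×n≡p {m} {n} {o} {p} m≤o n≤p eq
  with refl ← ≤-antisym m≤o
         -- From `o + p ≡ m + n` and `n ≤ p` follows `o + p ≤ m + p`, hence `o ≤ m`.
         (+-cancelʳ-≤ p o m (≤-trans (≤-reflexive (sym eq)) (+-monoʳ-≤ m n≤p)))
  = refl , +-cancelˡ-≡ m n p eq

-- An attained upper bound is independent of any enumeration of the domain, so maxima over `G`, `H`
-- and `G □ H` can be compared without relating their vertex lists.
IsMaximum : {A : Set} → (A → ℕ) → ℕ → Set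
IsMaximum f m = (∀ v → f v ≤ m) × ∃ λ v → f v ≡ m

IsMaximum-unique : ∀ {A : Set} {f : A → ℕ} {m n} →
                   IsMaximum f m → IsMaximum f n → m ≡ n
IsMaximum-unique (f≤m , v , fv≡m) (f≤n , w , fw≡n) = ≤-antisym
  (subst (_≤ _) fv≡m (f≤n v)) (subst (_≤ _) fw≡n (f≤m w))

-- The two coordinates vary independently, so maximisers of `f` and `g` can be paired.
IsMaximum-+ : ∀ {A B : Set} {f : A → ℕ} {g : B → ℕ} {h : A × B → ℕ} {m n} →
              (∀ a b → h (a , b) ≡ f a + g b) →
              IsMaximum f m → IsMaximum g n → IsMaximum h (m + n)
IsMaximum-+ h≡f+g (f≤m , v , fv≡m) (g≤n , w , gw≡n) =
  (λ (a , b) → ≤-trans (≤-reflexive (h≡f+g a b)) (+-mono-≤ (f≤m a) (g≤n b))) ,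
  (v , w) , trans (h≡f+g v w) (cong₂ _+_ fv≡m gw≡n)

module _ (G : Graph) where
  open Graph G
  open Inverse finite using (to; from; strictlyInverseʳ)

  vertex : V
  vertex = from (fromℕ< (>-nonZero⁻¹ order {{nonempty}}))

  ∈-vertices : ∀ v → v ∈ vertices
  ∈-vertices v = subst (_∈ vertices) (strictlyInverseʳ v) (∈-map⁺ from (∈-allFin (to v)))

  max-vertices : (f : V → ℕ) → IsMaximum f (max 0 (map f vertices))
  max-vertices f = f≤max , attained
    where
    f≤max : ∀ v → f v ≤ max 0 (map f vertices)
    f≤max v = All.lookup (xs≤max 0 (map f vertices)) (∈-map⁺ f (∈-vertices v))

    attained : ∃ λ v → f v ≡ max 0 (map f vertices)
    attained with argmax-sel id 0 (map f vertices)
    -- The maximum may be the default 0 instead of a list entry. Then `f` vanishes everywhere, and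
    -- any vertex attains it; one exists because the graph is nonempty.
    ... | inj₁ max≡0 =
      vertex , trans (n≤0⇒n≡0 (subst (f vertex ≤_) max≡0 (f≤max vertex))) (sym max≡0)
    ... | inj₂ max∈ with ∈-map⁻ f max∈
    ...   | v , _ , max≡fv = v , sym max≡fv

  ecc-isMaximum : ∀ v → IsMaximum (d G v) (ecc G v)
  ecc-isMaximum v = max-vertices (d G v)

  diam-isMaximum : IsMaximum (ecc G) (diam G)
  diam-isMaximum = max-vertices (ecc G)

  -- Pigeonhole: the positions of a repetition-free list inject into `V`, and hence into
  -- `Fin order`.
  length-unique≤order : ∀ {xs} → Unique xs → length xs ≤ order
  length-unique≤order unique = Fin.injective⇒≤
    (lookup-injective unique ∘ Injection.injective (↔⇒↣ finite))

  length-support : ∀ {u v k} (p : Walk G u v k) → length (support p) ≡ suc k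
  length-support []      = refl
  length-support (_ ∷ p) = cong suc (length-support p)

  -- The suffix of a path that starts at `u` is again a path.
  dropUntil : ∀ {u v w k} (p : Walk G w v k) → Unique (support p) → u ∈ support p →
              ∃ λ l → l ≤ k × Path G u v l
  dropUntil []      uq       (here refl) = _ , ≤-refl , [] , uq
  dropUntil (e ∷ p) uq       (here refl) = _ , ≤-refl , e ∷ p , uq
  dropUntil (e ∷ p) (_ ∷ uq) (there u∈)  =
    let l , l≤k , q = dropUntil p uq u∈ in l , m≤n⇒m≤1+n l≤k , q

  -- The tail is made a path first; if `u` already lies on it, the closed detour back to `u` is cut
  -- off. This lets arbitrary walks bound `d`, which is defined through paths.
  walk⇒path : ∀ {u v k} → Walk G u v k → ∃ λ l → l ≤ k × Path G u v l
  walk⇒path []          = 0 , z≤n , [] , All.[] ∷ []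
  walk⇒path {u} (e ∷ p) with walk⇒path p
  ... | l , l≤k , q , uq with DecMembership._∈?_ _≟_ u (support q)
  ...   | no  u∉ = suc l , s≤s l≤k , e ∷ q , ¬Any⇒All¬ _ u∉ ∷ uq
  ...   | yes u∈ = let l′ , l′≤l , r = dropUntil q uq u∈ in
    l′ , m≤n⇒m≤1+n (≤-trans l′≤l l≤k) , r

  d≤length : ∀ {u v k} → Walk G u v k → d G u v ≤ k
  d≤length {u} {v} p = let _ , l≤k , q = walk⇒path p in
    ≤-trans (leastBelow-≤ order (path? G u v) q) l≤k

  geodesic : Connected G → ∀ u v → Walk G u v (d G u v)
  geodesic conn u v with conn u v
  ... | _ , p , uq = proj₁ (leastBelow-satisfies order (path? G u v)
    -- A path of length `k` has `suc k` distinct vertices, so `k < order` and the search defining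
    -- `d` succeeds.
    (subst (_≤ order) (length-support p) (length-unique≤order uq)) (p , uq))

module _ (G H : Graph) where
  private
    module G = Graph G
    module H = Graph H

  □-walk : ∀ {a c b e k l} → Walk G a c k → Walk H b e l → Walk (G □ H) (a , b) (c , e) (k + l)
  □-walk []      []      = []
  □-walk []      (e ∷ q) = inj₂ (refl , e) ∷ □-walk [] q
  □-walk (e ∷ p) q       = inj₁ (e , refl) ∷ □-walk p q

  -- Each edge moves exactly one coordinate. The projections of a path may revisit vertices, which
  -- is why the splitting is stated for walks.
  □-walk⁻¹ : ∀ {a c b e n} → Walk (G □ H) (a , b) (c , e) n →
             ∃₂ λ k l → Walk G a c k × Walk H b e l × k + l ≡ n
  □-walk⁻¹ [] = 0 , 0 , [] , [] , refl
  □-walk⁻¹ (inj₁ (e , refl) ∷ r) =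
    let k , l , p , q , eq = □-walk⁻¹ r in suc k , l , e ∷ p , q , cong suc eq
  □-walk⁻¹ (inj₂ (refl , e) ∷ r) =
    let k , l , p , q , eq = □-walk⁻¹ r in
    k , suc l , p , e ∷ q , trans (+-suc k l) (cong suc eq)

  module _ (connG : Connected G) (connH : Connected H) where

    □-connected : Connected (G □ H)
    □-connected (a , b) (c , e) =
      let l , _ , p = walk⇒path (G □ H) (□-walk (geodesic G connG a c) (geodesic H connH b e))
      in l , p

    d-□ : ∀ a b c e → d (G □ H) (a , b) (c , e) ≡ d G a c + d H b e
    d-□ a b c e = ≤-antisym
      (d≤length (G □ H) (□-walk (geodesic G connG a c) (geodesic H connH b e)))
      (let _ , _ , p , q , eq = □-walk⁻¹ (geodesic (G □ H) □-connected (a , b) (c , e)) in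
       ≤-trans (+-mono-≤ (d≤length G p) (d≤length H q)) (≤-reflexive eq))

    ecc-□ : ∀ a b → ecc (G □ H) (a , b) ≡ ecc G a + ecc H b
    ecc-□ a b = IsMaximum-unique (ecc-isMaximum (G □ H) (a , b))
      (IsMaximum-+ (d-□ a b) (ecc-isMaximum G a) (ecc-isMaximum H b))

    diam-□ : diam (G □ H) ≡ diam G + diam H
    diam-□ = IsMaximum-unique (diam-isMaximum (G □ H))
      (IsMaximum-+ ecc-□ (diam-isMaximum G) (diam-isMaximum H))

    peripheryOf-□ : ∀ {a b c e} → PeripheryOf (G □ H) (a , b) (c , e) ⇔
                    (PeripheryOf G a c × PeripheryOf H b e)
    peripheryOf-□ {a} {b} {c} {e} = mk⇔
      (λ eq → m+n≡o+p⇒m≡o×n≡p (proj₁ (ecc-isMaximum G a) c) (proj₁ (ecc-isMaximum H b) e)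
                (subst₂ _≡_ (d-□ a b c e) (ecc-□ a b) eq))
      (λ (p , q) → subst₂ _≡_ (sym (d-□ a b c e)) (sym (ecc-□ a b)) (cong₂ _+_ p q))

    periphery-□ : ∀ {a b} → Periphery (G □ H) (a , b) ⇔ (Periphery G a × Periphery H b)
    periphery-□ {a} {b} = mk⇔
      (λ eq → m+n≡o+p⇒m≡o×n≡p (proj₁ (diam-isMaximum G) a) (proj₁ (diam-isMaximum H) b)
                (subst₂ _≡_ (ecc-□ a b) diam-□ eq))
      (λ (p , q) → subst₂ _≡_ (sym (ecc-□ a b)) (sym diam-□) (cong₂ _+_ p q))

theorem3 : (G H : Graph) → Connected G → Connected H → Hangable (G □ H) ⇔ (Hangable G × Hangable H)
theorem3 G H connG connH = mk⇔
  (λ (_ , hang) →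
    let peripheral : ∀ {a b c e} → PeripheryOf G a c → PeripheryOf H b e →
                     Periphery G c × Periphery H e
        peripheral p q = to (periphery-□ G H connG connH)
          (hang _ (from (peripheryOf-□ G H connG connH) (p , q)))
    in
    -- To use the product, `a` is paired with an arbitrary vertex of `H`, and the vertex farthest
    -- from `a` with one farthest from that vertex. The other factor is treated symmetrically.
    (connG , λ a p → proj₁ (peripheral p (proj₂ (proj₂ (ecc-isMaximum H (vertex H)))))) ,
    (connH , λ b q → proj₂ (peripheral (proj₂ (proj₂ (ecc-isMaximum G (vertex G)))) q)))
  (λ ((_ , hangG) , (_ , hangH)) →
    □-connected G H connG connH ,
    λ (a , b) r → let p , q = to (peripheryOf-□ G H connG connH) r in
      from (periphery-□ G H connG connH) (hangG a p , hangH b q))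
  where open Equivalence using (to; from)
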